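{- For every integer $n\geq 0$, \begin{align*} \overline{p}_{ -13}(8n+1) &\equiv 0 \pmod{2}, & \overline{p}_{ -13}(8n+2) &\equiv 0 \pmod{4}, & \overline{p}_{ -13}(8n+3) &\equiv 0 \pmod{8}, \\ \overline{p}_{ -13}(8n+4) &\equiv 0 \pmod{2}, & \overline{p}_{ -13}(8n+5) &\equiv 0 \pmod{8}, & \overline{p}_{ -13}(8n+6) &\equiv 0 \pmod{8}, \end{align*} and \[ \overline{p}_{ -13}(8n+7) \equiv 0 \pmod{256}. \]
   Context: For $|q|<1$ let $(a;q)_\infty=\prod_{i\geq 0}(1-aq^i)$. For a positive integer $t$, the number $\overline{p}_{ -t}(n)$ of $t$-colored overpartitions of $n$ is defined by the generating function \[ \sum_{n\geq 0}\overline{p}_{ -t}(n)q^n=\frac{(q^2;q^2)_\infty^t}{(q;q)_\infty^{2t}}. \] -}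

module Defs where

open import Data.Nat using (ℕ; zero; suc; _∸_; _≡ᵇ_)
open import Data.Nat.DivMod using (_%_)
open import Data.Bool using (if_then_else_)
open import Data.Integer using (ℤ; +_; -_) renaming (_+_ to _+ℤ_; _*_ to _*ℤ_)
open import Data.List using (List; map; upTo; foldr)

Series : Set
Series = ℕ → ℤ

sumℤ : List ℤ → ℤ
sumℤ = foldr _+ℤ_ (+ 0)

_·_ : Series → Series → Series
(f · g) n = sumℤ (map (λ k → f k *ℤ g (n ∸ k)) (upTo (suc n)))

one : Series
one zero = + 1
one (suc _) = + 0

_^s_ : Series → ℕ → Series
f ^s zero = one
f ^s suc k = f · (f ^s k)

-- 1 - q^m  (for m ≥ 1)
oneMinusQ : ℕ → Series
oneMinusQ m zero = + 1
oneMinusQ m (suc j) = if (suc j ≡ᵇ m) then - (+ 1) else + 0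

-- 1/(1 - q^m) = Σ_j q^{m j}  (for m ≥ 1)
invOneMinusQ : ℕ → Series
invOneMinusQ m j = if (j % suc (m ∸ 1) ≡ᵇ 0) then + 1 else + 0

partialProd : ℕ → ℕ → Series
partialProd t zero = one
partialProd t (suc N) =
  ((oneMinusQ (2 Data.Nat.* suc N) ^s t) · (invOneMinusQ (suc N) ^s (2 Data.Nat.* t)))
  · partialProd t N

-- Number of t-colored overpartitions: coefficient of q^n in
-- (q^2;q^2)_∞^t / (q;q)_∞^{2t}.  Factors with index i > n are ≡ 1 mod q^{n+1},
-- so the product truncated at N = n has the same coefficient of q^n.
pbar- : ℕ → ℕ → ℤ
pbar- t n = partialProd t n n

{-# OPTIONS --safe #-}
module Submission where

-- The t-colored generating function is φ(-q)^(-t), where Gauss' identity gives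
-- φ(-q) = (q;q)∞² / (q²;q²)∞ = Σ_{n ∈ ℤ} (-1)ⁿ q^(n²).  Since squares are 0, 1 or 4 mod 8, the
-- coefficients of φ(-q) at indices ≡ 0, …, 7 mod 8 are divisible by 1, 2, 0, 0, 2, 0, 0, 0.
-- Four squarings, each gaining a factor 2 in the off-diagonal products, give the divisors
-- 1, 32, 32, 128, 32, 64, 128, 256 for φ(-q)^16; this table is multiplicatively closed, so it also
-- holds for φ(-q)^(-16), and the theorem is read off from φ(-q)^(-13) = φ(-q)^(-16) φ(-q)^3.
--
-- Gauss' identity is proved modulo q^(N+1) from a finite identity of Shanks' type,
--   Σ_{|s| ≤ n} (-1)^s q^(s²) = Σ_{0 ≤ s ≤ n} (-1)^s (A_n / A_s) q^(s(n+1)) 2 / (1 + q^s),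
-- where A_n = Π_{1 ≤ i ≤ n} (1 - q^i) / (1 + q^i).

open import Defs
open import Data.Nat using (ℕ; _+_; _*_)
open import Data.Integer using (+_)
open import Data.Integer.Divisibility using (_∣_)
open import Data.Product using (_×_)

open import Algebra.Bundles using (CommutativeRing)
import Algebra.Properties.CommutativeSemiring.Exp as Exp
import Algebra.Solver.Ring as RingSolver
open import Algebra.Solver.Ring.AlmostCommutativeRing
  using (fromCommutativeRing; _-Raw-AlmostCommutative⟶_)
open import Algebra.Structures using (IsCommutativeRing)
open import Data.Bool using (true; false; if_then_else_; T)
open import Data.Fin using (Fin; toℕ)
open import Data.Fin.Properties using (all?; toℕ-fromℕ<; toℕ-injective)
open import Data.Integer using (ℤ; -_)
  renaming (_+_ to _+ℤ_; _*_ to _*ℤ_)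
import Data.Integer.Divisibility.Signed as ℤ∣
import Data.Integer.Properties as ℤ
open import Data.Integer.Tactic.RingSolver using (solve-∀)
open import Data.List.Properties using (map-applyUpTo; map-upTo)
open import Data.Maybe using (map)
open import Data.Nat using (zero; suc; _∸_; _≡ᵇ_; _≤_; _<_; z≤n; s≤s)
import Data.Nat.Divisibility as ℕ∣
open import Data.Nat.DivMod
  using (_%_; _mod_; %-distribˡ-+; %-distribˡ-*; m<n⇒m%n≡m; [m+n]%n≡m%n; [m+kn]%n≡m%n)
import Data.Nat.Properties as ℕ
open import Data.Nat.Induction using (<-rec)
open import Data.Product using (_,_)
open import Data.Unit using (tt)
open import Data.Vec using (Vec; []; _∷_; lookup)
open import Function using (_∘_)
open import Relation.Binary.PropositionalEquality
  using (_≡_; _≢_; refl; sym; trans; cong; cong₂; subst; subst₂; module ≡-Reasoning)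
import Relation.Binary.Reasoning.Setoid as ≈-Reasoning
open import Relation.Nullary using (Dec; yes; no; contradiction)
open import Relation.Nullary.Decidable using (True; toWitness; dec⇒maybe)

-- Formal power series

nil : Series
nil _ = + 0

mono : ℕ → Series
mono m k = if k ≡ᵇ m then + 1 else + 0

·-zero : ∀ f g → (f · g) 0 ≡ f 0 *ℤ g 0
·-zero f g = ℤ.+-identityʳ _

-- Peels off the summand with k = 0. With this recursion, facts about convolution follow by
-- induction on n, without further reasoning about lists.
·-suc : ∀ f g n → (f · g) (suc n) ≡ f 0 *ℤ g (suc n) +ℤ ((f ∘ suc) · g) n
·-suc f g n = cong (λ l → f 0 *ℤ g (suc n) +ℤ sumℤ l)
  (trans (map-applyUpTo suc (λ k → f k *ℤ g (suc n ∸ k)) (suc n))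
         (sym (map-upTo (λ k → f (suc k) *ℤ g (n ∸ k)) (suc n))))

-- Peels off the last summand instead. Combined with `·-suc` it yields commutativity and the pairing
-- of the two outermost summands; alone it isolates the top coefficient of `f` when a series is
-- inverted.
·-sucʳ : ∀ f g n → (f · g) (suc n) ≡ f (suc n) *ℤ g 0 +ℤ (f · (g ∘ suc)) n
·-sucʳ f g zero = begin
  (f · g) 1                          ≡⟨ ·-suc f g 0 ⟩
  f 0 *ℤ g 1 +ℤ ((f ∘ suc) · g) 0    ≡⟨ cong (f 0 *ℤ g 1 +ℤ_) (·-zero (f ∘ suc) g) ⟩
  f 0 *ℤ g 1 +ℤ f 1 *ℤ g 0           ≡⟨ ℤ.+-comm (f 0 *ℤ g 1) _ ⟩
  f 1 *ℤ g 0 +ℤ f 0 *ℤ g 1           ≡⟨ cong (f 1 *ℤ g 0 +ℤ_) (·-zero f (g ∘ suc)) ⟨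
  f 1 *ℤ g 0 +ℤ (f · (g ∘ suc)) 0    ∎
  where open ≡-Reasoning
·-sucʳ f g (suc n) = begin
  (f · g) (suc (suc n))
    ≡⟨ ·-suc f g (suc n) ⟩
  f 0 *ℤ g (suc (suc n)) +ℤ ((f ∘ suc) · g) (suc n)
    ≡⟨ cong (f 0 *ℤ g (suc (suc n)) +ℤ_) (·-sucʳ (f ∘ suc) g n) ⟩
  f 0 *ℤ g (suc (suc n)) +ℤ (f (suc (suc n)) *ℤ g 0 +ℤ ((f ∘ suc) · (g ∘ suc)) n)
    ≡⟨ swap (f 0 *ℤ g (suc (suc n))) (f (suc (suc n)) *ℤ g 0) _ ⟩
  f (suc (suc n)) *ℤ g 0 +ℤ (f 0 *ℤ g (suc (suc n)) +ℤ ((f ∘ suc) · (g ∘ suc)) n)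
    ≡⟨ cong (f (suc (suc n)) *ℤ g 0 +ℤ_) (·-suc f (g ∘ suc) n) ⟨
  f (suc (suc n)) *ℤ g 0 +ℤ (f · (g ∘ suc)) (suc n) ∎
  where
  open ≡-Reasoning
  swap : ∀ a b c → a +ℤ (b +ℤ c) ≡ b +ℤ (a +ℤ c)
  swap = solve-∀

-- A coefficient of a product sees only coefficients of index at most n, which is why multiplication
-- respects congruence modulo a power of q.
·-cong≤ : ∀ n {f f′ g g′} → (∀ k → k ≤ n → f k ≡ f′ k) → (∀ k → k ≤ n → g k ≡ g′ k) →
          (f · g) n ≡ (f′ · g′) n
·-cong≤ zero {f} {f′} {g} {g′} p q =
  trans (·-zero f g) (trans (cong₂ _*ℤ_ (p 0 z≤n) (q 0 z≤n)) (sym (·-zero f′ g′)))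
·-cong≤ (suc n) {f} {f′} {g} {g′} p q =
  trans (·-suc f g n)
    (trans (cong₂ _+ℤ_ (cong₂ _*ℤ_ (p 0 z≤n) (q (suc n) ℕ.≤-refl))
                       (·-cong≤ n (λ k k≤n → p (suc k) (s≤s k≤n))
                                  (λ k k≤n → q k (ℕ.m≤n⇒m≤1+n k≤n))))
           (sym (·-suc f′ g′ n)))

·-comm : ∀ n f g → (f · g) n ≡ (g · f) n
·-comm zero f g = trans (·-zero f g) (trans (ℤ.*-comm (f 0) (g 0)) (sym (·-zero g f)))
·-comm (suc n) f g =
  trans (·-suc f g n)
    (trans (cong₂ _+ℤ_ (ℤ.*-comm (f 0) (g (suc n))) (·-comm n (f ∘ suc) g))
           (sym (·-sucʳ g f n)))

·-distribʳ : ∀ n h f g → ((λ k → f k +ℤ g k) · h) n ≡ (f · h) n +ℤ (g · h) n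
·-distribʳ zero h f g =
  trans (·-zero (λ k → f k +ℤ g k) h)
    (trans (ℤ.*-distribʳ-+ (h 0) (f 0) (g 0)) (sym (cong₂ _+ℤ_ (·-zero f h) (·-zero g h))))
·-distribʳ (suc n) h f g = begin
  ((λ k → f k +ℤ g k) · h) (suc n)
    ≡⟨ ·-suc (λ k → f k +ℤ g k) h n ⟩
  (f 0 +ℤ g 0) *ℤ h (suc n) +ℤ ((λ k → f (suc k) +ℤ g (suc k)) · h) n
    ≡⟨ cong ((f 0 +ℤ g 0) *ℤ h (suc n) +ℤ_) (·-distribʳ n h (f ∘ suc) (g ∘ suc)) ⟩
  (f 0 +ℤ g 0) *ℤ h (suc n) +ℤ (((f ∘ suc) · h) n +ℤ ((g ∘ suc) · h) n)
    ≡⟨ regroup (f 0) (g 0) (h (suc n)) _ _ ⟩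
  (f 0 *ℤ h (suc n) +ℤ ((f ∘ suc) · h) n) +ℤ (g 0 *ℤ h (suc n) +ℤ ((g ∘ suc) · h) n)
    ≡⟨ cong₂ _+ℤ_ (·-suc f h n) (·-suc g h n) ⟨
  (f · h) (suc n) +ℤ (g · h) (suc n) ∎
  where
  open ≡-Reasoning
  regroup : ∀ a b c x y → (a +ℤ b) *ℤ c +ℤ (x +ℤ y) ≡ (a *ℤ c +ℤ x) +ℤ (b *ℤ c +ℤ y)
  regroup = solve-∀

*-·-assoc : ∀ n c f g → ((λ k → c *ℤ f k) · g) n ≡ c *ℤ (f · g) n
*-·-assoc zero c f g =
  trans (·-zero (λ k → c *ℤ f k) g)
    (trans (ℤ.*-assoc c (f 0) (g 0)) (cong (c *ℤ_) (sym (·-zero f g))))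
*-·-assoc (suc n) c f g = begin
  ((λ k → c *ℤ f k) · g) (suc n)
    ≡⟨ ·-suc (λ k → c *ℤ f k) g n ⟩
  c *ℤ f 0 *ℤ g (suc n) +ℤ ((λ k → c *ℤ f (suc k)) · g) n
    ≡⟨ cong (c *ℤ f 0 *ℤ g (suc n) +ℤ_) (*-·-assoc n c (f ∘ suc) g) ⟩
  c *ℤ f 0 *ℤ g (suc n) +ℤ c *ℤ ((f ∘ suc) · g) n
    ≡⟨ factor c (f 0) (g (suc n)) _ ⟩
  c *ℤ (f 0 *ℤ g (suc n) +ℤ ((f ∘ suc) · g) n)
    ≡⟨ cong (c *ℤ_) (·-suc f g n) ⟨
  c *ℤ (f · g) (suc n) ∎
  where
  open ≡-Reasoning
  factor : ∀ a b c x → a *ℤ b *ℤ c +ℤ a *ℤ x ≡ a *ℤ (b *ℤ c +ℤ x)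
  factor = solve-∀

-- By `·-suc`, the tail of `f · g` is a scalar multiple of the tail of `g` plus `(f ∘ suc) · g`;
-- distributivity, scalar associativity and induction then apply.
·-assoc : ∀ n f g h → ((f · g) · h) n ≡ (f · (g · h)) n
·-assoc zero f g h = begin
  ((f · g) · h) 0         ≡⟨ ·-zero (f · g) h ⟩
  (f · g) 0 *ℤ h 0        ≡⟨ cong (_*ℤ h 0) (·-zero f g) ⟩
  f 0 *ℤ g 0 *ℤ h 0       ≡⟨ ℤ.*-assoc (f 0) (g 0) (h 0) ⟩
  f 0 *ℤ (g 0 *ℤ h 0)     ≡⟨ cong (f 0 *ℤ_) (·-zero g h) ⟨
  f 0 *ℤ (g · h) 0        ≡⟨ ·-zero f (g · h) ⟨
  (f · (g · h)) 0         ∎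
  where open ≡-Reasoning
·-assoc (suc n) f g h = begin
  ((f · g) · h) (suc n)
    ≡⟨ ·-suc (f · g) h n ⟩
  (f · g) 0 *ℤ h (suc n) +ℤ (((f · g) ∘ suc) · h) n
    ≡⟨ cong₂ (λ x y → x *ℤ h (suc n) +ℤ y) (·-zero f g)
         (trans (·-cong≤ n {g = h} {g′ = h} (λ k _ → ·-suc f g k) (λ _ _ → refl))
           (·-distribʳ n h (λ k → f 0 *ℤ g (suc k)) ((f ∘ suc) · g))) ⟩
  f 0 *ℤ g 0 *ℤ h (suc n) +ℤ (((λ k → f 0 *ℤ g (suc k)) · h) n +ℤ (((f ∘ suc) · g) · h) n)
    ≡⟨ cong₂ (λ x y → f 0 *ℤ g 0 *ℤ h (suc n) +ℤ (x +ℤ y))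
         (*-·-assoc n (f 0) (g ∘ suc) h) (·-assoc n (f ∘ suc) g h) ⟩
  f 0 *ℤ g 0 *ℤ h (suc n) +ℤ (f 0 *ℤ ((g ∘ suc) · h) n +ℤ ((f ∘ suc) · (g · h)) n)
    ≡⟨ regroup (f 0) (g 0) (h (suc n)) _ _ ⟩
  f 0 *ℤ (g 0 *ℤ h (suc n) +ℤ ((g ∘ suc) · h) n) +ℤ ((f ∘ suc) · (g · h)) n
    ≡⟨ cong (λ x → f 0 *ℤ x +ℤ ((f ∘ suc) · (g · h)) n) (·-suc g h n) ⟨
  f 0 *ℤ (g · h) (suc n) +ℤ ((f ∘ suc) · (g · h)) n
    ≡⟨ ·-suc f (g · h) n ⟨
  (f · (g · h)) (suc n) ∎
  where
  open ≡-Reasoning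
  regroup : ∀ a b c x y → a *ℤ b *ℤ c +ℤ (a *ℤ x +ℤ y) ≡ a *ℤ (b *ℤ c +ℤ x) +ℤ y
  regroup = solve-∀

nil-· : ∀ n f → (nil · f) n ≡ + 0
nil-· zero f = refl
nil-· (suc n) f = trans (·-suc nil f n) (trans (ℤ.+-identityˡ _) (nil-· n f))

one-· : ∀ n f → (one · f) n ≡ f n
one-· zero f = trans (·-zero one f) (ℤ.*-identityˡ (f 0))
one-· (suc n) f =
  trans (·-suc one f n)
    (trans (cong₂ _+ℤ_ (ℤ.*-identityˡ (f (suc n))) (nil-· n f)) (ℤ.+-identityʳ (f (suc n))))

const-· : ∀ n c f → ((λ k → c *ℤ one k) · f) n ≡ c *ℤ f n
const-· n c f = trans (*-·-assoc n c one f) (cong (c *ℤ_) (one-· n f))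

mono-zero : ∀ n → mono 0 n ≡ one n
mono-zero zero = refl
mono-zero (suc n) = refl

mono-suc-· : ∀ m f n → (mono (suc m) · f) (suc n) ≡ (mono m · f) n
mono-suc-· m f n = trans (·-suc (mono (suc m)) f n) (ℤ.+-identityˡ _)

mono-·-< : ∀ m f n → n < m → (mono m · f) n ≡ + 0
mono-·-< (suc m) f zero _ = refl
mono-·-< (suc m) f (suc n) (s≤s n<m) = trans (mono-suc-· m f n) (mono-·-< m f n n<m)

mono-·-+ : ∀ m f n → (mono m · f) (m + n) ≡ f n
mono-·-+ zero f n = trans (·-cong≤ n {g = f} {g′ = f} (λ k _ → mono-zero k) (λ _ _ → refl)) (one-· n f)
mono-·-+ (suc m) f n = trans (mono-suc-· m f (m + n)) (mono-·-+ m f n)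

mono-· : ∀ a b n → (mono a · mono b) n ≡ mono (a + b) n
mono-· zero b n = mono-·-+ 0 (mono b) n
mono-· (suc a) b zero = refl
mono-· (suc a) b (suc n) = trans (mono-suc-· a (mono b) n) (mono-· a b n)

mono-< : ∀ m n → n < m → mono m n ≡ + 0
mono-< (suc m) zero _ = refl
mono-< (suc m) (suc n) (s≤s n<m) = mono-< m n n<m

oneMinusQ≡ : ∀ m n → oneMinusQ (suc m) n ≡ one n +ℤ - mono (suc m) n
oneMinusQ≡ m zero = refl
oneMinusQ≡ m (suc n) with n ≡ᵇ m
... | true = refl
... | false = refl

-- The geometric series satisfies I = 1 + q^(m+1) I. Below index m+1 only the constant term can be
-- nonzero; from there on the coefficients are periodic with period m+1.
invOneMinusQ-rec : ∀ m n →
  invOneMinusQ (suc m) n ≡ one n +ℤ (mono (suc m) · invOneMinusQ (suc m)) n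
invOneMinusQ-rec m n with n ℕ.<? suc m
... | yes n≤m = begin
  (if n % suc m ≡ᵇ 0 then + 1 else + 0)
    ≡⟨ cong (λ r → if r ≡ᵇ 0 then + 1 else + 0) (m<n⇒m%n≡m n≤m) ⟩
  (if n ≡ᵇ 0 then + 1 else + 0)
    ≡⟨ mono-zero n ⟩
  one n
    ≡⟨ ℤ.+-identityʳ (one n) ⟨
  one n +ℤ + 0
    ≡⟨ cong (one n +ℤ_) (mono-·-< (suc m) (invOneMinusQ (suc m)) n n≤m) ⟨
  one n +ℤ (mono (suc m) · invOneMinusQ (suc m)) n ∎
  where open ≡-Reasoning
... | no n≰m with ℕ.m≤n⇒∃[o]m+o≡n (ℕ.≮⇒≥ n≰m)
...   | j , refl = begin
  (if (suc m + j) % suc m ≡ᵇ 0 then + 1 else + 0)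
    ≡⟨ cong (λ r → if r ≡ᵇ 0 then + 1 else + 0)
         (trans (cong (_% suc m) (ℕ.+-comm (suc m) j)) ([m+n]%n≡m%n j (suc m))) ⟩
  invOneMinusQ (suc m) j
    ≡⟨ mono-·-+ (suc m) (invOneMinusQ (suc m)) j ⟨
  (mono (suc m) · invOneMinusQ (suc m)) (suc m + j)
    ≡⟨ ℤ.+-identityˡ _ ⟨
  + 0 +ℤ (mono (suc m) · invOneMinusQ (suc m)) (suc m + j) ∎
  where open ≡-Reasoning

∣-· : ∀ {e} n f g → (∀ i j → i + j ≡ n → e ℤ∣.∣ f i *ℤ g j) → e ℤ∣.∣ (f · g) n
∣-· {e} zero f g p = subst (e ℤ∣.∣_) (sym (·-zero f g)) (p 0 0 refl)
∣-· {e} (suc n) f g p = subst (e ℤ∣.∣_) (sym (·-suc f g n))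
  (ℤ∣.∣m∣n⇒∣m+n (p 0 (suc n) refl)
                (∣-· n (f ∘ suc) g λ i j i+j≡n → p (suc i) j (cong suc i+j≡n)))

-- For f = g the first hypothesis gains the factor 2 of f i f j + f j f i.
∣-·-pairs : ∀ {e} n f g →
  (∀ i j → i + j ≡ n → e ℤ∣.∣ f i *ℤ g j +ℤ f j *ℤ g i) →
  (∀ i → i + i ≡ n → e ℤ∣.∣ f i *ℤ g i) →
  e ℤ∣.∣ (f · g) n
∣-·-pairs {e} zero f g p q = subst (e ℤ∣.∣_) (sym (·-zero f g)) (q 0 refl)
∣-·-pairs {e} (suc zero) f g p q = subst (e ℤ∣.∣_)
  (sym (trans (·-suc f g 0) (cong (f 0 *ℤ g 1 +ℤ_) (·-zero (f ∘ suc) g)))) (p 0 1 refl)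
∣-·-pairs {e} (suc (suc n)) f g p q = subst (e ℤ∣.∣_) (sym split)
  (ℤ∣.∣m∣n⇒∣m+n (p 0 (suc (suc n)) refl)
    (∣-·-pairs n (f ∘ suc) (g ∘ suc)
      (λ i j i+j≡n → p (suc i) (suc j) (shift i j i+j≡n))
      (λ i i+i≡n → q (suc i) (shift i i i+i≡n))))
  where
  open ≡-Reasoning
  shift : ∀ i j → i + j ≡ n → suc i + suc j ≡ suc (suc n)
  shift i j i+j≡n = cong suc (trans (ℕ.+-suc i j) (cong suc i+j≡n))
  split : (f · g) (suc (suc n)) ≡
    (f 0 *ℤ g (suc (suc n)) +ℤ f (suc (suc n)) *ℤ g 0) +ℤ ((f ∘ suc) · (g ∘ suc)) n
  split = begin
    (f · g) (suc (suc n))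
      ≡⟨ ·-suc f g (suc n) ⟩
    f 0 *ℤ g (suc (suc n)) +ℤ ((f ∘ suc) · g) (suc n)
      ≡⟨ cong (f 0 *ℤ g (suc (suc n)) +ℤ_) (·-sucʳ (f ∘ suc) g n) ⟩
    f 0 *ℤ g (suc (suc n)) +ℤ (f (suc (suc n)) *ℤ g 0 +ℤ ((f ∘ suc) · (g ∘ suc)) n)
      ≡⟨ ℤ.+-assoc (f 0 *ℤ g (suc (suc n))) _ _ ⟨
    (f 0 *ℤ g (suc (suc n)) +ℤ f (suc (suc n)) *ℤ g 0) +ℤ ((f ∘ suc) · (g ∘ suc)) n ∎

mono-≢ : ∀ m n → n ≢ m → mono m n ≡ + 0
mono-≢ m n n≢m with n ≡ᵇ m in eq
... | true = contradiction (ℕ.≡ᵇ⇒≡ n m (subst T (sym eq) tt)) n≢m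
... | false = refl

-- Divisibility of coefficients by residue of the index

Table : Set
Table = Vec ℕ 8

infix 9 _!_

_!_ : Table → ℕ → ℕ
c ! n = lookup c (n mod 8)

-- The subscript is the power of φ(-q) that the table belongs to; an entry 0 means that the
-- coefficients vanish.
d₁ d₂ d₃ d₄ d₈ d₁₆ d₋₁₃ : Table
d₁   = 1 ∷ 2 ∷ 0 ∷ 0 ∷ 2 ∷ 0 ∷ 0 ∷ 0 ∷ []
d₂   = 1 ∷ 4 ∷ 4 ∷ 0 ∷ 4 ∷ 8 ∷ 0 ∷ 0 ∷ []
d₃   = 1 ∷ 2 ∷ 4 ∷ 8 ∷ 2 ∷ 8 ∷ 8 ∷ 0 ∷ []
d₄   = 1 ∷ 8 ∷ 8 ∷ 32 ∷ 8 ∷ 16 ∷ 32 ∷ 64 ∷ []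
d₈   = 1 ∷ 16 ∷ 16 ∷ 64 ∷ 16 ∷ 32 ∷ 64 ∷ 128 ∷ []
d₁₆  = 1 ∷ 32 ∷ 32 ∷ 128 ∷ 32 ∷ 64 ∷ 128 ∷ 256 ∷ []
d₋₁₃ = 1 ∷ 2 ∷ 4 ∷ 8 ∷ 2 ∷ 8 ∷ 8 ∷ 256 ∷ []

mod-cong : ∀ m n → m % 8 ≡ n % 8 → m mod 8 ≡ n mod 8
mod-cong m n eq = toℕ-injective
  (trans (toℕ-fromℕ< _) (trans eq (sym (toℕ-fromℕ< _))))

toℕ-mod : ∀ n → toℕ (n mod 8) ≡ n % 8
toℕ-mod n = toℕ-fromℕ< _

-- Replacing indices by their residues turns divisibility claims about all pairs of indices into a
-- check of 64 pairs.
!-+ : ∀ c i j → c ! (i + j) ≡ c ! (toℕ (i mod 8) + toℕ (j mod 8))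
!-+ c i j = cong (lookup c) (mod-cong (i + j) (toℕ (i mod 8) + toℕ (j mod 8)) (trans (%-distribˡ-+ i j 8)
  (cong₂ (λ a b → (a + b) % 8) (sym (toℕ-mod i)) (sym (toℕ-mod j)))))

!-* : ∀ c i j → c ! (i * j) ≡ c ! (toℕ (i mod 8) * toℕ (j mod 8))
!-* c i j = cong (lookup c) (mod-cong (i * j) (toℕ (i mod 8) * toℕ (j mod 8)) (trans (%-distribˡ-* i j 8)
  (cong₂ (λ a b → (a * b) % 8) (sym (toℕ-mod i)) (sym (toℕ-mod j)))))

-- The factor `k` is 1 for a general product and 2 for the off-diagonal part of a square. Being
-- decidable, the condition is discharged by evaluation wherever concrete tables are supplied.
productTable? : ∀ k c d e →
  Dec (∀ (a b : Fin 8) → e ! (toℕ a + toℕ b) ℕ∣.∣ k * (lookup c a * lookup d b))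
productTable? k c d e = all? λ a → all? λ b → _ ℕ∣.∣? _

diagonalTable? : ∀ c e → Dec (∀ (a : Fin 8) → e ! (toℕ a + toℕ a) ℕ∣.∣ lookup c a * lookup c a)
diagonalTable? c e = all? λ a → _ ℕ∣.∣? _

squareTable? : ∀ c e → Dec (∀ (a : Fin 8) → e ! (toℕ a * toℕ a) ℕ∣.∣ c)
squareTable? c e = all? λ a → _ ℕ∣.∣? _

*-mono-∣ : ∀ {a b x y} → + a ℤ∣.∣ x → + b ℤ∣.∣ y → + (a * b) ℤ∣.∣ x *ℤ y
*-mono-∣ {a} {b} {x} {y} p q = ℤ∣.∣-trans
  (ℤ∣.∣-reflexive (ℤ.pos-* a b))
  (ℤ∣.∣-trans (ℤ∣.*-monoˡ-∣ (+ b) p) (ℤ∣.*-monoʳ-∣ x q))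

-- Ring operations on series

-- The ring operations are opaque so that unification never unfolds a convolution.

infixl 6 _⊕_
infixl 7 _⊗_
infix 8 ⊖_

opaque
  _⊕_ : Series → Series → Series
  (f ⊕ g) n = f n +ℤ g n

  ⊖_ : Series → Series
  (⊖ f) n = - f n

  _⊗_ : Series → Series → Series
  _⊗_ = _·_

  const : ℤ → Series
  const c n = c *ℤ one n

opaque
  unfolding _⊕_

  ⊕-at : ∀ f g n → (f ⊕ g) n ≡ f n +ℤ g n
  ⊕-at f g n = refl

  const-⊗ : ∀ n c f → (const c ⊗ f) n ≡ c *ℤ f n
  const-⊗ = const-·

  ⊗-zero : ∀ f g → (f ⊗ g) 0 ≡ f 0 *ℤ g 0
  ⊗-zero = ·-zero

  ⊗-sucʳ : ∀ f g n → (f ⊗ g) (suc n) ≡ f (suc n) *ℤ g 0 +ℤ (f · (g ∘ suc)) n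
  ⊗-sucʳ = ·-sucʳ

  ∣-⊗ : ∀ {e} n f g → (∀ i j → i + j ≡ n → e ℤ∣.∣ f i *ℤ g j) → e ℤ∣.∣ (f ⊗ g) n
  ∣-⊗ = ∣-·

  ∣-⊗-pairs : ∀ {e} n f g →
    (∀ i j → i + j ≡ n → e ℤ∣.∣ f i *ℤ g j +ℤ f j *ℤ g i) →
    (∀ i → i + i ≡ n → e ℤ∣.∣ f i *ℤ g i) →
    e ℤ∣.∣ (f ⊗ g) n
  ∣-⊗-pairs = ∣-·-pairs

  mono-⊗ : ∀ a b n → (mono a ⊗ mono b) n ≡ mono (a + b) n
  mono-⊗ = mono-·

  oneMinusQ-⊕ : ∀ m n → oneMinusQ (suc m) n ≡ (one ⊕ ⊖ mono (suc m)) n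
  oneMinusQ-⊕ = oneMinusQ≡

  invOneMinusQ-⊕ : ∀ m n →
    invOneMinusQ (suc m) n ≡ (one ⊕ mono (suc m) ⊗ invOneMinusQ (suc m)) n
  invOneMinusQ-⊕ = invOneMinusQ-rec

  partialProd-suc : ∀ t N → partialProd t (suc N) ≡
    ((oneMinusQ (2 * suc N) ^s t) ⊗ (invOneMinusQ (suc N) ^s (2 * t))) ⊗ partialProd t N
  partialProd-suc t N = refl

  ^s-suc : ∀ f k → f ^s suc k ≡ f ⊗ (f ^s k)
  ^s-suc f k = refl

-- Series modulo q ^ (N + 1)

module Truncated (N : ℕ) where

  infix 4 _≈_

  -- A record instead of a bare function type keeps `f` and `g` visible to unification.
  record _≈_ (f g : Series) : Set where
    constructor mk
    field at : ∀ k → k ≤ N → f k ≡ g k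
  open _≈_ public

  exact : ∀ {f g} → (∀ k → f k ≡ g k) → f ≈ g
  exact p = mk λ k _ → p k

  opaque
    unfolding _⊕_

    isCommutativeRing : IsCommutativeRing _≈_ _⊕_ _⊗_ ⊖_ nil one
    isCommutativeRing = record
      { isRing = record
        { +-isAbelianGroup = record
          { isGroup = record
            { isMonoid = record
              { isSemigroup = record
                { isMagma = record
                  { isEquivalence = record
                    { refl = exact λ _ → refl
                    ; sym = λ p → mk λ k k≤N → sym (at p k k≤N)
                    ; trans = λ p q → mk λ k k≤N → trans (at p k k≤N) (at q k k≤N)
                    }
                  ; ∙-cong = λ p q → mk λ k k≤N → cong₂ _+ℤ_ (at p k k≤N) (at q k k≤N)
                  }
                ; assoc = λ f g h → exact λ k → ℤ.+-assoc (f k) (g k) (h k)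
                }
              ; identity = (λ f → exact λ k → ℤ.+-identityˡ (f k))
                         , (λ f → exact λ k → ℤ.+-identityʳ (f k))
              }
            ; inverse = (λ f → exact λ k → ℤ.+-inverseˡ (f k))
                      , (λ f → exact λ k → ℤ.+-inverseʳ (f k))
            ; ⁻¹-cong = λ p → mk λ k k≤N → cong -_ (at p k k≤N)
            }
          ; comm = λ f g → exact λ k → ℤ.+-comm (f k) (g k)
          }
        ; *-cong = λ p q → mk λ k k≤N →
            ·-cong≤ k (λ i i≤k → at p i (ℕ.≤-trans i≤k k≤N)) (λ i i≤k → at q i (ℕ.≤-trans i≤k k≤N))
        ; *-assoc = λ f g h → exact λ k → ·-assoc k f g h
        ; *-identity = (λ f → exact λ k → one-· k f)
                     , (λ f → exact λ k → trans (·-comm k f one) (one-· k f))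
        ; distrib = (λ f g h → exact λ k →
                       trans (·-comm k f (λ i → g i +ℤ h i))
                         (trans (·-distribʳ k f g h) (cong₂ _+ℤ_ (·-comm k g f) (·-comm k h f))))
                  , (λ f g h → exact λ k → ·-distribʳ k f g h)
        }
      ; *-comm = λ f g → exact λ k → ·-comm k f g
      }

  ring : CommutativeRing _ _
  ring = record { isCommutativeRing = isCommutativeRing }

  open CommutativeRing ring public
    using (setoid; commutativeSemiring; -‿cong)
    renaming ( refl to ≈-refl; sym to ≈-sym; trans to ≈-trans; *-cong to ⊗-cong
             ; *-congˡ to ⊗-congˡ; *-congʳ to ⊗-congʳ; +-cong to ⊕-cong; +-congˡ to ⊕-congˡ
             ; +-congʳ to ⊕-congʳ; *-identityˡ to ⊗-identityˡ; *-identityʳ to ⊗-identityʳ)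

  ≡⇒≈ : ∀ {f g} → f ≡ g → f ≈ g
  ≡⇒≈ refl = ≈-refl

  opaque
    unfolding _⊕_

    const-+ : ∀ c d → const (c +ℤ d) ≈ const c ⊕ const d
    const-+ c d = exact λ k → ℤ.*-distribʳ-+ (one k) c d

    const-* : ∀ c d → const (c *ℤ d) ≈ const c ⊗ const d
    const-* c d = exact λ k → trans (ℤ.*-assoc c d (one k)) (sym (const-· k c (const d)))

    const-neg : ∀ c → const (- c) ≈ ⊖ const c
    const-neg c = exact λ k → sym (ℤ.neg-distribˡ-* c (one k))

    const-0 : const (+ 0) ≈ nil
    const-0 = exact λ _ → refl

    const-1 : const (+ 1) ≈ one
    const-1 = exact λ k → ℤ.*-identityˡ (one k)

  -- Makes the integers the coefficients of the ring solver, so that numerals such as 2 are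
  -- normalised by computation.
  constMorphism : CommutativeRing.rawRing ℤ.+-*-commutativeRing
                  -Raw-AlmostCommutative⟶ fromCommutativeRing ring
  constMorphism = record
    { ⟦_⟧ = const
    ; +-homo = const-+
    ; *-homo = const-*
    ; -‿homo = const-neg
    ; 0-homo = const-0
    ; 1-homo = const-1
    }

  open RingSolver _ _ constMorphism
    (λ c d → map (λ c≡d → ≡⇒≈ (cong const c≡d)) (dec⇒maybe (c ℤ.≟ d)))
    public using (solve; _:=_; _:+_; _:*_; _:-_; :-_; _:^_; con)


  -- The factors 1 ± q^m and their inverses

  one≈const : one ≈ const (+ 1)
  one≈const = ≈-sym const-1

  mono-+ : ∀ a b → mono (a + b) ≈ mono a ⊗ mono b
  mono-+ a b = exact λ k → sym (mono-⊗ a b k)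

  -- The unit is written `const (+ 1)`, the form that solver expressions evaluate to.
  one₊ one₋ : ℕ → Series
  one₊ m = const (+ 1) ⊕ mono m
  one₋ m = const (+ 1) ⊕ ⊖ mono m

  oneMinusQ≈ : ∀ m → oneMinusQ (suc m) ≈ one₋ (suc m)
  oneMinusQ≈ m = ≈-trans (exact (oneMinusQ-⊕ m)) (⊕-congʳ one≈const)

  one₋-double : ∀ m → one₋ (2 * m) ≈ one₋ m ⊗ one₊ m
  one₋-double m = begin
    const (+ 1) ⊕ ⊖ mono (m + (m + 0))
      ≈⟨ ⊕-congˡ (-‿cong (≈-trans (≡⇒≈ (cong (λ k → mono (m + k)) (ℕ.+-identityʳ m))) (mono-+ m m))) ⟩
    const (+ 1) ⊕ ⊖ (mono m ⊗ mono m)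
      ≈⟨ solve 1 (λ x → con (+ 1) :- x :* x := (con (+ 1) :- x) :* (con (+ 1) :+ x)) ≈-refl (mono m) ⟩
    one₋ m ⊗ one₊ m ∎
    where open ≈-Reasoning setoid

  invOneMinusQ-inverse : ∀ m → invOneMinusQ (suc m) ⊗ one₋ (suc m) ≈ const (+ 1)
  invOneMinusQ-inverse m = begin
    invOneMinusQ (suc m) ⊗ one₋ (suc m)
      ≈⟨ solve 2 (λ y x → y :* (con (+ 1) :- x) := y :- x :* y) ≈-refl
           (invOneMinusQ (suc m)) (mono (suc m)) ⟩
    invOneMinusQ (suc m) ⊕ ⊖ (mono (suc m) ⊗ invOneMinusQ (suc m))
      ≈⟨ ⊕-congʳ (≈-trans (exact (invOneMinusQ-⊕ m)) (⊕-congʳ one≈const)) ⟩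
    (const (+ 1) ⊕ mono (suc m) ⊗ invOneMinusQ (suc m)) ⊕ ⊖ (mono (suc m) ⊗ invOneMinusQ (suc m))
      ≈⟨ solve 1 (λ z → (con (+ 1) :+ z) :- z := con (+ 1)) ≈-refl
           (mono (suc m) ⊗ invOneMinusQ (suc m)) ⟩
    const (+ 1) ∎
    where open ≈-Reasoning setoid

  one₋-cancelˡ : ∀ m {f g} → one₋ (suc m) ⊗ f ≈ one₋ (suc m) ⊗ g → f ≈ g
  one₋-cancelˡ m {f} {g} p = ≈-trans (≈-sym (undo f)) (≈-trans (⊗-congˡ p) (undo g))
    where
    undo : ∀ h → invOneMinusQ (suc m) ⊗ (one₋ (suc m) ⊗ h) ≈ h
    undo h = ≈-trans
      (solve 3 (λ y x z → y :* (x :* z) := (y :* x) :* z) ≈-refl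
        (invOneMinusQ (suc m)) (one₋ (suc m)) h)
      (≈-trans (⊗-congʳ (invOneMinusQ-inverse m))
        (solve 1 (λ z → con (+ 1) :* z := z) ≈-refl h))

  -- The finite theta identity and Gauss' identity

  -- P m = 1 / A_m.
  P : ℕ → Series
  P = partialProd 1

  -- With x = q^(m+1), the new factor is (1 - x²) / (1 - x)² = (1 + x) / (1 - x).
  P-suc : ∀ m → one₋ (suc m) ⊗ P (suc m) ≈ one₊ (suc m) ⊗ P m
  P-suc m = begin
    one₋ (suc m) ⊗ P (suc m)
      ≡⟨ cong (one₋ (suc m) ⊗_) (partialProd-suc 1 m) ⟩
    one₋ (suc m) ⊗ (((O ^s 1) ⊗ (I ^s 2)) ⊗ P m)
      ≈⟨ ⊗-congˡ (⊗-congʳ (⊗-cong (≡⇒≈ (^s-suc O 0))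
           (≈-trans (≡⇒≈ (^s-suc I 1)) (⊗-congˡ (≡⇒≈ (^s-suc I 0)))))) ⟩
    one₋ (suc m) ⊗ ((O ⊗ one) ⊗ (I ⊗ (I ⊗ one)) ⊗ P m)
      ≈⟨ ⊗-congˡ (⊗-congʳ (⊗-cong
           (⊗-cong (≈-trans (oneMinusQ≈ _) (one₋-double (suc m))) one≈const)
           (⊗-congˡ (⊗-congˡ one≈const)))) ⟩
    one₋ (suc m) ⊗ ((((one₋ (suc m) ⊗ one₊ (suc m)) ⊗ const (+ 1)) ⊗ (I ⊗ (I ⊗ const (+ 1)))) ⊗ P m)
      ≈⟨ solve 4 (λ a b i p →
           a :* (((a :* b) :* con (+ 1) :* (i :* (i :* con (+ 1)))) :* p)
           := (i :* a) :* (i :* a) :* (b :* p)) ≈-refl (one₋ (suc m)) (one₊ (suc m)) I (P m) ⟩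
    ((I ⊗ one₋ (suc m)) ⊗ (I ⊗ one₋ (suc m))) ⊗ (one₊ (suc m) ⊗ P m)
      ≈⟨ ⊗-congʳ (⊗-cong (invOneMinusQ-inverse m) (invOneMinusQ-inverse m)) ⟩
    (const (+ 1) ⊗ const (+ 1)) ⊗ (one₊ (suc m) ⊗ P m)
      ≈⟨ solve 1 (λ z → con (+ 1) :* con (+ 1) :* z := z) ≈-refl (one₊ (suc m) ⊗ P m) ⟩
    one₊ (suc m) ⊗ P m ∎
    where
    open ≈-Reasoning setoid
    O = oneMinusQ (2 * suc m)
    I = invOneMinusQ (suc m)

  -- 2 / (1 + q^s).
  E : ℕ → Series
  E zero = const (+ 1)
  E (suc s) = const (+ 2) ⊗ (one₋ (suc s) ⊗ invOneMinusQ (2 * suc s))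

  -- Uses 1 / (1 + x) = (1 - x) / (1 - x²), which expresses the inverse through the available
  -- geometric series.
  E-suc : ∀ s → E (suc s) ⊗ one₊ (suc s) ≈ const (+ 2)
  E-suc s = begin
    (const (+ 2) ⊗ (one₋ (suc s) ⊗ I)) ⊗ one₊ (suc s)
      ≈⟨ solve 3 (λ a i b → (con (+ 2) :* (a :* i)) :* b := con (+ 2) :* (i :* (a :* b)))
           ≈-refl (one₋ (suc s)) I (one₊ (suc s)) ⟩
    const (+ 2) ⊗ (I ⊗ (one₋ (suc s) ⊗ one₊ (suc s)))
      ≈⟨ ⊗-congˡ (≈-trans (⊗-congˡ (≈-sym (one₋-double (suc s)))) (invOneMinusQ-inverse _)) ⟩
    const (+ 2) ⊗ const (+ 1)
      ≈⟨ solve 0 (con (+ 2) :* con (+ 1) := con (+ 2)) ≈-refl ⟩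
    const (+ 2) ∎
    where
    open ≈-Reasoning setoid
    I = invOneMinusQ (2 * suc s)

  sgn : ℕ → ℤ
  sgn zero = + 1
  sgn (suc s) = - sgn s

  sgn-suc : ∀ s → const (sgn (suc s)) ≈ ⊖ const (sgn s)
  sgn-suc s = const-neg (sgn s)

  -- The partial sums of φ(-q); the indices s and -s contribute equally, hence the factor 2.
  S : ℕ → Series
  S zero = one
  S (suc m) = S m ⊕ const (+ 2) ⊗ (const (sgn (suc m)) ⊗ mono (suc m * suc m))

  -- A summand of the finite identity divided by A_n, so that n survives only in the exponent of q.
  term : ℕ → ℕ → Series
  term n s = (const (sgn s) ⊗ P s) ⊗ (mono (s * suc n) ⊗ E s)

  -- The upper limit m is separate from n, so that the sums for n and n+1 can be compared over the
  -- same range.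
  Θ : ℕ → ℕ → Series
  Θ n zero = const (+ 1)
  Θ n (suc m) = Θ n m ⊕ term n (suc m)

  boundary : ℕ → ℕ → Series
  boundary n m = const (+ 2) ⊗ (const (sgn m) ⊗ (mono (suc m * n) ⊗ P m))

  term-suc : ∀ n s → term n (suc s) ≈
    ((⊖ const (sgn s)) ⊗ P (suc s)) ⊗ ((mono (suc s) ⊗ mono (suc s * n)) ⊗ E (suc s))
  term-suc n s = ⊗-cong (⊗-congʳ (sgn-suc s))
    (⊗-congʳ (≈-trans (≡⇒≈ (cong mono (ℕ.*-suc (suc s) n))) (mono-+ (suc s) (suc s * n))))

  -- term (suc n) s - A_{n+1}⁻¹ A_n term n s telescopes in s; the factor 1 - q^(n+1) clears denominators.
  Θ-telescope : ∀ n m →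
    one₋ (suc n) ⊗ Θ (suc n) m ≈ one₊ (suc n) ⊗ Θ n m ⊕ ⊖ boundary (suc n) m
  Θ-telescope n zero = begin
    one₋ (suc n) ⊗ const (+ 1)
      ≈⟨ solve 1 (λ x → (con (+ 1) :- x) :* con (+ 1) :=
           (con (+ 1) :+ x) :* con (+ 1) :- con (+ 2) :* (con (+ 1) :* (x :* con (+ 1))))
           ≈-refl (mono (suc n)) ⟩
    one₊ (suc n) ⊗ const (+ 1) ⊕ ⊖ (const (+ 2) ⊗ (const (+ 1) ⊗ (mono (suc n) ⊗ const (+ 1))))
      ≈⟨ ⊕-congˡ (-‿cong (⊗-congˡ (⊗-congˡ (⊗-cong
           (≡⇒≈ (cong mono (sym (ℕ.*-identityˡ (suc n))))) (≈-sym one≈const))))) ⟩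
    one₊ (suc n) ⊗ const (+ 1) ⊕ ⊖ boundary (suc n) zero ∎
    where open ≈-Reasoning setoid
  Θ-telescope n (suc m) = begin
    one₋ n′ ⊗ (Θ n′ m ⊕ term n′ m′)
      ≈⟨ solve 3 (λ a b c → a :* (b :+ c) := a :* b :+ a :* c) ≈-refl (one₋ n′) (Θ n′ m) (term n′ m′) ⟩
    one₋ n′ ⊗ Θ n′ m ⊕ one₋ n′ ⊗ term n′ m′
      ≈⟨ ⊕-cong (Θ-telescope n m) (⊗-congˡ (term-suc n′ m)) ⟩
    (one₊ n′ ⊗ Θ n m ⊕ ⊖ boundary n′ m) ⊕ one₋ n′ ⊗ ((⊖ s ⊗ P m′) ⊗ ((x ⊗ y) ⊗ e))
      -- The right side is the goal plus multiples of two differences that vanish by `P-suc` and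
      -- `E-suc`; the multipliers make this a polynomial identity.
      ≈⟨ solve 8 (λ Q t s P₀ P₁ x y e →
           ((con (+ 1) :+ Q) :* t :- con (+ 2) :* (s :* (y :* P₀)))
             :+ (con (+ 1) :- Q) :* ((:- s :* P₁) :* ((x :* y) :* e))
           := (((con (+ 1) :+ Q) :* (t :+ (:- s :* P₁) :* (y :* e))
                :- con (+ 2) :* (:- s :* ((Q :* y) :* P₁)))
              :+ (s :* (y :* e)) :* ((con (+ 1) :- x) :* P₁ :- (con (+ 1) :+ x) :* P₀))
              :+ ((s :* y) :* (P₀ :+ Q :* P₁)) :* (e :* (con (+ 1) :+ x) :- con (+ 2)))
           ≈-refl (mono n′) (Θ n m) s (P m) (P m′) x y e ⟩
    (goal ⊕ (s ⊗ (y ⊗ e)) ⊗ (one₋ m′ ⊗ P m′ ⊕ ⊖ (one₊ m′ ⊗ P m)))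
      ⊕ ((s ⊗ y) ⊗ (P m ⊕ mono n′ ⊗ P m′)) ⊗ (e ⊗ one₊ m′ ⊕ ⊖ const (+ 2))
      ≈⟨ ⊕-cong (⊕-congˡ (⊗-congˡ (⊕-congʳ (P-suc m)))) (⊗-congˡ (⊕-congʳ (E-suc m))) ⟩
    (goal ⊕ (s ⊗ (y ⊗ e)) ⊗ (one₊ m′ ⊗ P m ⊕ ⊖ (one₊ m′ ⊗ P m)))
      ⊕ ((s ⊗ y) ⊗ (P m ⊕ mono n′ ⊗ P m′)) ⊗ (const (+ 2) ⊕ ⊖ const (+ 2))
      ≈⟨ solve 4 (λ g a b c → (g :+ a :* (b :- b)) :+ c :* (con (+ 2) :- con (+ 2)) := g) ≈-refl
           goal (s ⊗ (y ⊗ e)) (one₊ m′ ⊗ P m) ((s ⊗ y) ⊗ (P m ⊕ mono n′ ⊗ P m′)) ⟩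
    goal
      ≈⟨ ⊕-cong (⊗-congˡ (⊕-congˡ (⊗-congʳ (⊗-congʳ (sgn-suc m)))))
           (-‿cong (⊗-congˡ (⊗-cong (sgn-suc m) (⊗-congʳ (mono-+ n′ (m′ * n′)))))) ⟨
    one₊ n′ ⊗ (Θ n m ⊕ term n m′) ⊕ ⊖ boundary n′ m′ ∎
    where
    open ≈-Reasoning setoid
    n′ = suc n
    m′ = suc m
    s = const (sgn m)
    x = mono m′
    y = mono (m′ * n′)
    e = E m′
    goal = one₊ n′ ⊗ (Θ n m ⊕ ((⊖ s) ⊗ P m′) ⊗ (y ⊗ e))
             ⊕ ⊖ (const (+ 2) ⊗ ((⊖ s) ⊗ ((mono n′ ⊗ y) ⊗ P m′)))

  -- Induction on n. After multiplication by 1 - q^(n+1), the boundary term of the telescoping and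
  -- the extra summand s = n+1 combine into the new theta term 2 (-1)^(n+1) q^((n+1)²).
  Θ-diagonal : ∀ n → Θ n n ≈ P n ⊗ S n
  Θ-diagonal zero = ≈-trans (≈-sym one≈const) (≈-sym (⊗-identityˡ one))
  Θ-diagonal (suc n) = one₋-cancelˡ n (begin
    one₋ n′ ⊗ (Θ n′ n ⊕ term n′ n′)
      ≈⟨ solve 3 (λ a b c → a :* (b :+ c) := a :* b :+ a :* c) ≈-refl (one₋ n′) (Θ n′ n) (term n′ n′) ⟩
    one₋ n′ ⊗ Θ n′ n ⊕ one₋ n′ ⊗ term n′ n′
      ≈⟨ ⊕-cong (≈-trans (Θ-telescope n n) (⊕-congʳ (⊗-congˡ (Θ-diagonal n))))
                (⊗-congˡ (term-suc n′ n)) ⟩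
    (one₊ n′ ⊗ (P n ⊗ S n) ⊕ ⊖ boundary n′ n) ⊕ one₋ n′ ⊗ ((⊖ s ⊗ P n′) ⊗ ((x ⊗ y) ⊗ e))
      -- Again the goal plus multiples of the vanishing differences from `P-suc` and `E-suc`. One
      -- variable `Q` serves both roles, since here s = n+1.
      ≈⟨ solve 7 (λ Q s P₀ P₁ y e t →
           ((con (+ 1) :+ Q) :* (P₀ :* t) :- con (+ 2) :* (s :* (y :* P₀)))
             :+ (con (+ 1) :- Q) :* ((:- s :* P₁) :* ((Q :* y) :* e))
           := ((con (+ 1) :- Q) :* (P₁ :* (t :+ con (+ 2) :* (:- s :* y)))
              :+ (con (+ 2) :* (s :* y) :- t :- s :* (y :* (Q :* e)))
                 :* ((con (+ 1) :- Q) :* P₁ :- (con (+ 1) :+ Q) :* P₀))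
              :+ (s :* (y :* (P₀ :* Q))) :* (con (+ 2) :- e :* (con (+ 1) :+ Q)))
           ≈-refl x s (P n) (P n′) y e (S n) ⟩
    (goal ⊕ c ⊗ (one₋ n′ ⊗ P n′ ⊕ ⊖ (one₊ n′ ⊗ P n))) ⊕ d ⊗ (const (+ 2) ⊕ ⊖ (e ⊗ one₊ n′))
      ≈⟨ ⊕-cong (⊕-congˡ (⊗-congˡ (⊕-congʳ (P-suc n)))) (⊗-congˡ (⊕-congˡ (-‿cong (E-suc n)))) ⟩
    (goal ⊕ c ⊗ (one₊ n′ ⊗ P n ⊕ ⊖ (one₊ n′ ⊗ P n))) ⊕ d ⊗ (const (+ 2) ⊕ ⊖ const (+ 2))
      ≈⟨ solve 4 (λ g a b c → (g :+ a :* (b :- b)) :+ c :* (con (+ 2) :- con (+ 2)) := g) ≈-refl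
           goal c (one₊ n′ ⊗ P n) d ⟩
    goal
      ≈⟨ ⊗-congˡ (⊗-congˡ (⊕-congˡ (⊗-congˡ (⊗-congʳ (sgn-suc n))))) ⟨
    one₋ n′ ⊗ (P n′ ⊗ S n′) ∎)
    where
    open ≈-Reasoning setoid
    n′ = suc n
    s = const (sgn n)
    x = mono n′
    y = mono (n′ * n′)
    e = E n′
    c = (const (+ 2) ⊗ (s ⊗ y) ⊕ ⊖ S n) ⊕ ⊖ (s ⊗ (y ⊗ (x ⊗ e)))
    d = s ⊗ (y ⊗ (P n ⊗ x))
    goal = one₋ n′ ⊗ (P n′ ⊗ (S n ⊕ const (+ 2) ⊗ ((⊖ s) ⊗ y)))

  -- Every summand with s ≥ 1 carries q^(s(N+1)) and vanishes modulo q^(N+1); only s = 0 survives.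
  Θ-truncated : ∀ m → Θ N m ≈ const (+ 1)
  Θ-truncated zero = ≈-refl
  Θ-truncated (suc m) = begin
    Θ N m ⊕ (const (sgn (suc m)) ⊗ P (suc m)) ⊗ (mono (suc m * suc N) ⊗ E (suc m))
      ≈⟨ ⊕-cong (Θ-truncated m) (⊗-congˡ (⊗-congʳ (≈-trans
           (mk λ k k≤N → mono-< (suc m * suc N) k (s≤s (ℕ.≤-trans k≤N (ℕ.m≤m+n N _))))
           (≈-sym const-0)))) ⟩
    const (+ 1) ⊕ (const (sgn (suc m)) ⊗ P (suc m)) ⊗ (const (+ 0) ⊗ E (suc m))
      ≈⟨ solve 2 (λ a e → con (+ 1) :+ a :* (con (+ 0) :* e) := con (+ 1)) ≈-refl
           (const (sgn (suc m)) ⊗ P (suc m)) (E (suc m)) ⟩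
    const (+ 1) ∎
    where open ≈-Reasoning setoid

  -- Evaluates `Θ N N` in two ways.
  gauss : P N ⊗ S N ≈ one
  gauss = ≈-trans (≈-sym (Θ-diagonal N)) (≈-trans (Θ-truncated N) (≈-sym one≈const))

  -- Powers of the one-colored product

  open Exp commutativeSemiring using (_^_; ^-distrib-*; ^-assocʳ; ^-congˡ)

  ^s≈^ : ∀ f k → f ^s k ≈ f ^ k
  ^s≈^ f zero = ≈-refl
  ^s≈^ f (suc k) = ≈-trans (≡⇒≈ (^s-suc f k)) (⊗-congˡ (^s≈^ f k))

  one^ : ∀ k → one ^ k ≈ one
  one^ zero = ≈-refl
  one^ (suc k) = ≈-trans (⊗-identityˡ (one ^ k)) (one^ k)

  -- Both exponents, t and 2t, are multiples of t, so each factor is a t-th power of the one-colored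
  -- factor.
  partialProd≈P^ : ∀ t m → partialProd t m ≈ P m ^ t
  partialProd≈P^ t zero = ≈-sym (one^ t)
  partialProd≈P^ t (suc m) = begin
    partialProd t (suc m)
      ≡⟨ partialProd-suc t m ⟩
    ((O ^s t) ⊗ (I ^s (2 * t))) ⊗ partialProd t m
      ≈⟨ ⊗-cong (⊗-cong (^s≈^ O t) (^s≈^ I (2 * t))) (partialProd≈P^ t m) ⟩
    ((O ^ t) ⊗ (I ^ (2 * t))) ⊗ (P m ^ t)
      ≈⟨ ⊗-congʳ (⊗-cong (^-congˡ t (≈-trans (^s≈^ O 1) (⊗-identityʳ O)))
           (≈-trans (^-congˡ t (^s≈^ I 2)) (^-assocʳ I 2 t))) ⟨
    (((O ^s 1) ^ t) ⊗ ((I ^s 2) ^ t)) ⊗ (P m ^ t)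
      ≈⟨ ⊗-congʳ (^-distrib-* (O ^s 1) (I ^s 2) t) ⟨
    (((O ^s 1) ⊗ (I ^s 2)) ^ t) ⊗ (P m ^ t)
      ≈⟨ ^-distrib-* ((O ^s 1) ⊗ (I ^s 2)) (P m) t ⟨
    (((O ^s 1) ⊗ (I ^s 2)) ⊗ P m) ^ t
      ≡⟨ cong (_^ t) (partialProd-suc 1 m) ⟨
    P (suc m) ^ t ∎
    where
    open ≈-Reasoning setoid
    O = oneMinusQ (2 * suc m)
    I = invOneMinusQ (suc m)

  sq : Series → Series
  sq f = f ⊗ f

  sq⁴-inverse : ∀ {f g} → f ⊗ g ≈ one → sq (sq (sq (sq f))) ⊗ sq (sq (sq (sq g))) ≈ one
  sq⁴-inverse = sq-inverse ∘ sq-inverse ∘ sq-inverse ∘ sq-inverse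
    where
    sq-inverse : ∀ {f g} → f ⊗ g ≈ one → sq f ⊗ sq g ≈ one
    sq-inverse {f} {g} p = ≈-trans
      (solve 2 (λ f g → (f :* f) :* (g :* g) := (f :* g) :* (f :* g)) ≈-refl f g)
      (≈-trans (⊗-cong p p) (⊗-identityˡ one))

  -- Since 13 = 16 - 3, three factors `P N ⊗ S N ≈ one` are inserted; a sixteenth power is reachable
  -- by squarings.
  partialProd-13 : partialProd 13 N ≈ sq (sq (sq (sq (P N)))) ⊗ (S N ⊗ sq (S N))
  partialProd-13 = begin
    partialProd 13 N
      ≈⟨ partialProd≈P^ 13 N ⟩
    P N ^ 13
      ≈⟨ ⊗-identityʳ (P N ^ 13) ⟨
    (P N ^ 13) ⊗ one
      ≈⟨ ⊗-congˡ (one^ 3) ⟨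
    (P N ^ 13) ⊗ (one ^ 3)
      ≈⟨ ⊗-congˡ (^-congˡ 3 gauss) ⟨
    (P N ^ 13) ⊗ ((P N ⊗ S N) ^ 3)
      -- The sixteenth power is bracketed as four nested squares to agree with `sq` by unfolding.
      ≈⟨ solve 2 (λ p s → (p :^ 13) :* ((p :* s) :^ 3) :=
           (((p :* p) :* (p :* p)) :* ((p :* p) :* (p :* p)))
             :* (((p :* p) :* (p :* p)) :* ((p :* p) :* (p :* p))) :* (s :* (s :* s)))
           ≈-refl (P N) (S N) ⟩
    sq (sq (sq (sq (P N)))) ⊗ (S N ⊗ sq (S N)) ∎
    where open ≈-Reasoning setoid

  -- Divisibility tables under products, squares and inverses

  Divides : Table → Series → Set
  Divides d f = ∀ k → k ≤ N → + (d ! k) ℤ∣.∣ f k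

  Divides-resp-≈ : ∀ {d f g} → f ≈ g → Divides d f → Divides d g
  Divides-resp-≈ f≈g p k k≤N = subst (_ ℤ∣.∣_) (at f≈g k k≤N) (p k k≤N)

  Divides-⊗ : ∀ c d e {f g} → {True (productTable? 1 c d e)} →
              Divides c f → Divides d g → Divides e (f ⊗ g)
  Divides-⊗ c d e {f} {g} {ok} p q k k≤N = ∣-⊗ k f g λ i j i+j≡k →
    ℤ∣.∣-trans
      (ℤ∣.∣ᵤ⇒∣ (subst₂ ℕ∣._∣_
        (trans (sym (!-+ e i j)) (cong (e !_) i+j≡k)) (ℕ.*-identityˡ _)
        (toWitness ok (i mod 8) (j mod 8))))
      (*-mono-∣ (p i (ℕ.≤-trans (ℕ.m≤m+n i j) (subst (_≤ N) (sym i+j≡k) k≤N)))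
                (q j (ℕ.≤-trans (ℕ.m≤n+m j i) (subst (_≤ N) (sym i+j≡k) k≤N))))

  -- Off-diagonal products occur twice and gain a factor 2; the diagonal product, at index i + i,
  -- occurs once and needs its own check.
  Divides-sq : ∀ c e {f} → {True (productTable? 2 c c e)} → {True (diagonalTable? c e)} →
               Divides c f → Divides e (sq f)
  Divides-sq c e {f} {ok₂} {ok₁} p k k≤N = ∣-⊗-pairs k f f
    (λ i j i+j≡k → subst (_ ℤ∣.∣_) (double (f i) (f j))
      (ℤ∣.∣-trans
        (ℤ∣.∣ᵤ⇒∣ (subst (ℕ∣._∣ _)
          (trans (sym (!-+ e i j)) (cong (e !_) i+j≡k))
          (toWitness ok₂ (i mod 8) (j mod 8))))
        (*-mono-∣ {2} ℤ∣.∣-refl (*-mono-∣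
          (p i (ℕ.≤-trans (ℕ.m≤m+n i j) (subst (_≤ N) (sym i+j≡k) k≤N)))
          (p j (ℕ.≤-trans (ℕ.m≤n+m j i) (subst (_≤ N) (sym i+j≡k) k≤N)))))))
    (λ i i+i≡k → ℤ∣.∣-trans
      (ℤ∣.∣ᵤ⇒∣ (subst (ℕ∣._∣ _)
        (trans (sym (!-+ e i i)) (cong (e !_) i+i≡k))
        (toWitness ok₁ (i mod 8))))
      (*-mono-∣ (p i (ℕ.≤-trans (ℕ.m≤m+n i i) (subst (_≤ N) (sym i+i≡k) k≤N)))
                (p i (ℕ.≤-trans (ℕ.m≤m+n i i) (subst (_≤ N) (sym i+i≡k) k≤N)))))
    where
    double : ∀ a b → + 2 *ℤ (a *ℤ b) ≡ a *ℤ b +ℤ b *ℤ a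
    double = solve-∀

  -- Strong induction: as `g 0` is 1, a coefficient of `f` of positive index is minus a sum of
  -- products of earlier coefficients of `f` with coefficients of `g`, and `d` is closed under such
  -- products. The entry 1 at residue 0 settles the start.
  Divides-inverse : ∀ d {f g} → {True (productTable? 1 d d d)} → lookup d (0 mod 8) ≡ 1 →
    f ⊗ g ≈ one → g 0 ≡ + 1 → Divides d g → Divides d f
  Divides-inverse d {f} {g} {ok} d₀≡1 fg≈1 g₀≡1 p = <-rec _ step
    where
    step : ∀ k → (∀ {i} → i < k → i ≤ N → + (d ! i) ℤ∣.∣ f i) → k ≤ N → + (d ! k) ℤ∣.∣ f k
    step zero _ _ = subst (λ x → + x ℤ∣.∣ f 0) (sym d₀≡1) (ℤ∣.divides (f 0) (sym (ℤ.*-identityʳ (f 0))))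
    step (suc k) ih k<N = ℤ∣.∣m+n∣n⇒∣m {m = f (suc k)}
      (subst (_ ℤ∣.∣_) (sym vanish) (ℤ∣.divides (+ 0) refl))
      (∣-· k f (g ∘ suc) λ i j i+j≡k →
        let i≤k = subst (i ≤_) i+j≡k (ℕ.m≤m+n i j)
            j≤k = subst (j ≤_) i+j≡k (ℕ.m≤n+m j i)
        in ℤ∣.∣-trans
          (ℤ∣.∣ᵤ⇒∣ (subst₂ ℕ∣._∣_
            (trans (sym (!-+ d i (suc j))) (cong (d !_) (trans (ℕ.+-suc i j) (cong suc i+j≡k))))
            (ℕ.*-identityˡ _)
            (toWitness ok (i mod 8) (suc j mod 8))))
          (*-mono-∣ (ih (s≤s i≤k) (ℕ.≤-trans i≤k (ℕ.<⇒≤ k<N)))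
                    (p (suc j) (ℕ.≤-trans (s≤s j≤k) k<N))))
      where
      open ≡-Reasoning
      vanish : f (suc k) +ℤ (f · (g ∘ suc)) k ≡ + 0
      vanish = begin
        f (suc k) +ℤ (f · (g ∘ suc)) k
          ≡⟨ cong (_+ℤ (f · (g ∘ suc)) k) (ℤ.*-identityʳ (f (suc k))) ⟨
        f (suc k) *ℤ + 1 +ℤ (f · (g ∘ suc)) k
          ≡⟨ cong (λ x → f (suc k) *ℤ x +ℤ (f · (g ∘ suc)) k) g₀≡1 ⟨
        f (suc k) *ℤ g 0 +ℤ (f · (g ∘ suc)) k
          ≡⟨ ⊗-sucʳ f g k ⟨
        (f ⊗ g) (suc k)
          ≡⟨ at fg≈1 (suc k) k<N ⟩
        + 0 ∎

  -- Apart from the constant term 1, where the entry is 1, only terms ±2 q^(s²) occur.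
  Divides-S : ∀ m → Divides d₁ (S m)
  Divides-S zero zero _ = ℤ∣.∣-refl
  Divides-S zero (suc k) _ = ℤ∣.divides (+ 0) refl
  Divides-S (suc m) k k≤N = subst (_ ℤ∣.∣_) (sym coefficient)
    (ℤ∣.∣m∣n⇒∣m+n (Divides-S m k k≤N) square)
    where
    s = suc m * suc m
    coefficient : S (suc m) k ≡ S m k +ℤ + 2 *ℤ (sgn (suc m) *ℤ mono s k)
    coefficient = trans (⊕-at (S m) _ k) (cong (S m k +ℤ_)
      (trans (const-⊗ k (+ 2) _) (cong (+ 2 *ℤ_) (const-⊗ k (sgn (suc m)) (mono s)))))
    square : + (d₁ ! k) ℤ∣.∣ + 2 *ℤ (sgn (suc m) *ℤ mono s k)
    square with k ℕ.≟ s
    -- A square is 0, 1 or 4 modulo 8, and there the entries 1, 2, 2 of `d₁` all divide 2.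
    ... | yes refl = ℤ∣.∣m⇒∣m*n {m = + 2} _ (ℤ∣.∣ᵤ⇒∣ (subst (ℕ∣._∣ 2) (sym (!-* d₁ (suc m) (suc m)))
                       (toWitness {a? = squareTable? 2 d₁} _ (suc m mod 8))))
    ... | no k≢s = subst (λ x → _ ℤ∣.∣ + 2 *ℤ (sgn (suc m) *ℤ x)) (sym (mono-≢ s k k≢s))
                     (ℤ∣.∣n⇒∣m*n (+ 2) (ℤ∣.∣n⇒∣m*n (sgn (suc m)) (ℤ∣.divides (+ 0) refl)))

  S-zero : ∀ m → S m 0 ≡ + 1
  S-zero zero = refl
  S-zero (suc m) = trans (⊕-at (S m) _ 0) (cong₂ _+ℤ_ (S-zero m)
    (trans (const-⊗ 0 (+ 2) _) (cong (+ 2 *ℤ_)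
      (trans (const-⊗ 0 (sgn (suc m)) _) (ℤ.*-zeroʳ (sgn (suc m)))))))

  sq-zero : ∀ {f} → f 0 ≡ + 1 → sq f 0 ≡ + 1
  sq-zero {f} p = trans (⊗-zero f f) (cong₂ _*ℤ_ p p)

  -- Four squarings lead from `d₁` to `d₁₆` for the sixteenth power of `S N`; inversion carries
  -- `d₁₆` over to that of `P N`, and the cube of `S N` supplies `d₃`.
  Divides-pbar₁₃ : Divides d₋₁₃ (partialProd 13 N)
  Divides-pbar₁₃ = Divides-resp-≈ {d₋₁₃} (≈-sym partialProd-13)
    (Divides-⊗ d₁₆ d₃ d₋₁₃
      (Divides-inverse d₁₆ refl (sq⁴-inverse gauss)
        (sq-zero (sq-zero (sq-zero (sq-zero (S-zero N)))))
        (Divides-sq d₈ d₁₆ (Divides-sq d₄ d₈ (Divides-sq d₂ d₄ S²))))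
      (Divides-⊗ d₁ d₂ d₃ (Divides-S N) S²))
    where
    S² : Divides d₂ (sq (S N))
    S² = Divides-sq d₁ d₂ (Divides-S N)

-- The residue classes modulo 8

theorem1p4 : (n : ℕ) →
    ((+ 2) ∣ pbar- 13 (8 * n + 1)) ×
    ((+ 4) ∣ pbar- 13 (8 * n + 2)) ×
    ((+ 8) ∣ pbar- 13 (8 * n + 3)) ×
    ((+ 2) ∣ pbar- 13 (8 * n + 4)) ×
    ((+ 8) ∣ pbar- 13 (8 * n + 5)) ×
    ((+ 8) ∣ pbar- 13 (8 * n + 6)) ×
    ((+ 256) ∣ pbar- 13 (8 * n + 7))
-- The closed lookups `d₋₁₃ ! r` evaluate to the seven moduli.
theorem1p4 n = at-residue 1 , at-residue 2 , at-residue 3 , at-residue 4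
             , at-residue 5 , at-residue 6 , at-residue 7
  where
  at-residue : ∀ r → + (d₋₁₃ ! r) ∣ pbar- 13 (8 * n + r)
  at-residue r = subst (λ x → + x ∣ pbar- 13 (8 * n + r))
    (cong (lookup d₋₁₃) (mod-cong (8 * n + r) r (trans
      (cong (_% 8) (trans (ℕ.+-comm (8 * n) r) (cong (_+_ r) (ℕ.*-comm 8 n))))
      ([m+kn]%n≡m%n r n 8))))
    -- The precision N is the index itself, matching the truncation in `pbar-`.
    (ℤ∣.∣⇒∣ᵤ (Truncated.Divides-pbar₁₃ (8 * n + r) (8 * n + r) ℕ.≤-refl))
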